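{- For all constraint lists $C, C_2$ and all substitutions $\sigma',\sigma'',\sigma'''$: if $\mathsf{unify}(C)=\sigma'$ and $\mathsf{unify}(\sigma'(C_2))=\sigma''$ and $\mathsf{unify}(C\mathbin{+\!\!+}C_2)=\sigma'''$, then $\sigma'''\approx(\sigma'\circ\sigma'')$.
   Context: Types: fix a set of type variables (with decidable equality), ranged over by $\alpha,\beta,\dots$. Types are generated by $\tau ::= \alpha \mid \tau_1 \rightarrow \tau_2$. Free variables of a type (a list): $\mathsf{FTV}(\alpha) = [\alpha]$, $\mathsf{FTV}(\tau\rightarrow\tau') = \mathsf{FTV}(\tau) \mathbin{+\!\!+} \mathsf{FTV}(\tau')$, where $+\!\!+$ is list append. "$\alpha$ occurs in $\tau$" means $\alpha\in\mathsf{FTV}(\tau)$. Constraints: a constraint is a formal equation $\tau \stackrel{\rm e}{=} \tau'$ between types; a constraint list is a finite list of constraints. Substitutions: a substitution $\sigma$ is a finite map (finite partial function) from type variables to types. $\sigma_{\mathbb{E}}$ is the empty finite map and $\{\alpha\mapsto\tau\}$ the map whose only binding sends $\alpha$ to $\tau$. Application: $\sigma(\alpha)=\tau$ if $\langle\alpha,\tau\rangle\in\sigma$, $\sigma(\alpha)=\alpha$ if $\alpha$ is not bound by $\sigma$; $\sigma(\tau_1\rightarrow\tau_2)=\sigma(\tau_1)\rightarrow\sigma(\tau_2)$; $\sigma(\tau_1\stackrel{\rm e}{=}\tau_2) = (\sigma(\tau_1)\stackrel{\rm e}{=}\sigma(\tau_2))$; and $\sigma(C)$ is obtained by applying $\sigma$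 to each constraint in the list $C$. Extensional equality: $\sigma\approx\sigma'$ means $\sigma(\alpha)=\sigma'(\alpha)$ for all type variables $\alpha$. Composition: $\sigma\circ\sigma'$ is the finite map that binds $\alpha$ to $\sigma'(\tau)$ if $\langle\alpha,\tau\rangle\in\sigma$; binds $\alpha$ to $\tau'$ if $\alpha$ is not bound by $\sigma$ and $\langle\alpha,\tau'\rangle\in\sigma'$; and leaves $\alpha$ unbound otherwise. Unification: $\mathsf{unify}$ takes a constraint list and either fails ($\mathsf{None}$) or succeeds with a substitution ($\mathsf{Some}\;\sigma$); "$\mathsf{unify}(C)=\sigma$" means that it succeeds with result exactly $\sigma$. It is defined by (with $\tau$ a non-variable type in the third and fourth clauses, and failure of a recursive call propagating): (1) $\mathsf{unify}([\,]) = \sigma_{\mathbb{E}}$; (2) $\mathsf{unify}((\alpha\stackrel{\rm e}{=}\beta)::C) = \mathsf{unify}(C)$ if $\alpha=\beta$, else $\{\alpha\mapsto\beta\}\circ\mathsf{unify}(\{\alpha\mapsto\beta\}(C))$; (3) $\mathsf{unify}((\alpha\stackrel{\rm e}{=}\tau)::C)$ fails if $\alpha$ occurs in $\tau$, else is $\{\alpha\mapsto\tau\}\circ\mathsf{unify}(\{\alpha\mapsto\tau\}(C))$; (4) $\mathsf{unify}((\tau\stackrel{\rm e}{=}\alpha)::C)$ fails if $\alpha$ occurs in $\tau$, else is $\{\alpha\mapsto\tau\}\circ\mathsf{unify}(\{\alpha\mapsto\tau\}(C))$; (5) $\mathsf{unify}((\tau_1\rightarrow\tau_2\stackrel{\rm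 e}{=}\tau_3\rightarrow\tau_4)::C) = \mathsf{unify}((\tau_1\stackrel{\rm e}{=}\tau_3)::(\tau_2\stackrel{\rm e}{=}\tau_4)::C)$. This is a total function by well-founded recursion on the lexicographically ordered triple (number of distinct variables in the list, total number of arrows in the list, length of the list). -}

module Defs where

open import Data.List.Base using (List; []; _∷_; [_]; _++_; map; concatMap; deduplicate; length)
open import Data.List.Membership.Propositional using (_∈_; _∉_)
open import Data.List.Membership.Propositional.Properties
  using (∈-++⁺ˡ; ∈-++⁺ʳ; ∈-++⁻; ∈-∃++; ∈-deduplicate⁺; ∈-deduplicate⁻)
open import Data.List.Properties using (length-++)
open import Data.List.Relation.Binary.Subset.Propositional using (_⊆_)
import Data.List.Relation.Unary.All as All
open import Data.List.Relation.Unary.All.Properties using (¬Any⇒All¬)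
open import Data.List.Relation.Unary.AllPairs using (_∷_)
open import Data.List.Relation.Unary.Any using (here; there)
open import Data.List.Relation.Unary.Unique.Propositional using (Unique)
open import Data.Maybe.Base as Maybe using (Maybe; just; nothing; fromMaybe)
open import Data.Maybe.Relation.Binary.Pointwise using (Pointwise)
open import Data.Nat.Base using (ℕ; suc; _+_; _≤_; _<_; z≤n; s≤s)
open import Data.Nat.Induction using (<-wellFounded)
open import Data.Nat.ListAction using (sum)
import Data.Nat.Properties as ℕ
open import Data.Nat.Solver using (module +-*-Solver)
open import Data.Product.Base using (_×_; _,_)
open import Data.Product.Relation.Binary.Lex.Strict using (×-Lex; ×-wellFounded)
open import Data.Sum.Base using (_⊎_; inj₁; inj₂)
open import Induction.WellFounded using (Acc; acc; WellFounded; module Subrelation)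
open import Level using (Level)
open import Relation.Binary.Core using (Rel)
import Relation.Binary.Construct.On as On
open import Relation.Binary.Definitions using (DecidableEquality)
open import Relation.Binary.PropositionalEquality
  using (_≡_; _≢_; refl; sym; trans; cong; subst)
open import Relation.Nullary using (yes; no; contradiction)

module Unification {a : Level} {A : Set a} (_≟_ : DecidableEquality A) where

  open import Data.List.Membership.DecPropositional _≟_ using (_∈?_)
  open import Data.List.Relation.Unary.Unique.DecPropositional.Properties _≟_ using (deduplicate-!)

  infixr 7 _⇒_
  infix  6 _=ᵉ_
  infixr 5 _∘_
  infix  4 _≈_ _≋_ _≋ₘ_ _≺_

  data Type : Set a where
    var : A → Type
    _⇒_ : Type → Type → Type

  FTV : Type → List A
  FTV (var α)  = [ α ]
  FTV (τ ⇒ τ′) = FTV τ ++ FTV τ′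

  data Constraint : Set a where
    _=ᵉ_ : Type → Type → Constraint

  -- Finite maps are association lists in which the first binding of a variable
  -- shadows later ones.  Distinct lists can thus represent the same finite map;
  -- equality of finite maps is _≋_ below.
  Subst : Set a
  Subst = List (A × Type)

  lookup : Subst → A → Maybe Type
  lookup []            α = nothing
  lookup ((β , τ) ∷ σ) α with α ≟ β
  ... | yes _ = just τ
  ... | no  _ = lookup σ α

  ∅ : Subst
  ∅ = []

  _↦_ : A → Type → Subst
  α ↦ τ = [ (α , τ) ]

  apply : Subst → Type → Type
  apply σ (var α)   = fromMaybe (var α) (lookup σ α)
  apply σ (τ₁ ⇒ τ₂) = apply σ τ₁ ⇒ apply σ τ₂

  applyᶜ : Subst → Constraint → Constraint
  applyᶜ σ (τ₁ =ᵉ τ₂) = apply σ τ₁ =ᵉ apply σ τ₂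

  applyᴸ : Subst → List Constraint → List Constraint
  applyᴸ σ = map (applyᶜ σ)

  -- Diagrammatic order: σ acts first.  A variable bound by σ to τ is bound to
  -- apply σ′ τ; the bindings of σ′ are only reached by variables unbound in σ.
  _∘_ : Subst → Subst → Subst
  σ ∘ σ′ = map (λ (α , τ) → α , apply σ′ τ) σ ++ σ′

  _≈_ : Rel Subst a
  σ ≈ σ′ = ∀ α → apply σ (var α) ≡ apply σ′ (var α)

  -- The same variables bound to the same types.  Finer than _≈_, which does not
  -- distinguish α ↦ var α from ∅.
  _≋_ : Rel Subst a
  σ ≋ σ′ = ∀ α → lookup σ α ≡ lookup σ′ α

  _≋ₘ_ : Rel (Maybe Subst) a
  _≋ₘ_ = Pointwise _≋_

  FTVᴸ : List Constraint → List A
  FTVᴸ = concatMap λ { (τ₁ =ᵉ τ₂) → FTV τ₁ ++ FTV τ₂ }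

  arrows : Type → ℕ
  arrows (var α)   = 0
  arrows (τ₁ ⇒ τ₂) = suc (arrows τ₁ + arrows τ₂)

  arrowsᴸ : List Constraint → ℕ
  arrowsᴸ C = sum (map (λ { (τ₁ =ᵉ τ₂) → arrows τ₁ + arrows τ₂ }) C)

  #vars : List Constraint → ℕ
  #vars C = length (deduplicate _≟_ (FTVᴸ C))

  measure : List Constraint → ℕ × ℕ × ℕ
  measure C = #vars C , arrowsᴸ C , length C

  -- A record, so that proofs of _≺_ do not unfold to the _≟_ tests in #vars,
  -- which would be caught by the with-abstractions over α ≟ β in unifyAcc.
  record _≺_ (C D : List Constraint) : Set where
    constructor decrease
    field measure-< : ×-Lex _≡_ _<_ (×-Lex _≡_ _<_ _<_) (measure C) (measure D)

  open _≺_

  ≺-wellFounded : WellFounded _≺_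
  ≺-wellFounded = Subrelation.wellFounded measure-< (On.wellFounded measure
    (×-wellFounded <-wellFounded (×-wellFounded <-wellFounded <-wellFounded)))

  Unique-⊆⇒length≤ : ∀ {xs ys : List A} → Unique xs → xs ⊆ ys → length xs ≤ length ys
  Unique-⊆⇒length≤ {[]}     _           _  = z≤n
  Unique-⊆⇒length≤ {x ∷ xs} (x∉xs ∷ u) xs⊆ys with ∈-∃++ (xs⊆ys (here refl))
  ... | as , bs , refl = subst (suc (length xs) ≤_) (sym eq) (s≤s (Unique-⊆⇒length≤ u sub))
    where
    eq : length (as ++ x ∷ bs) ≡ suc (length (as ++ bs))
    eq = trans (length-++ as) (trans (ℕ.+-suc (length as) (length bs)) (cong suc (sym (length-++ as))))

    sub : xs ⊆ as ++ bs
    sub z∈xs with ∈-++⁻ as (xs⊆ys (there z∈xs))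
    ... | inj₁ z∈as         = ∈-++⁺ˡ z∈as
    ... | inj₂ (here refl)  = contradiction refl (All.lookup x∉xs z∈xs)
    ... | inj₂ (there z∈bs) = ∈-++⁺ʳ as z∈bs

  #vars-≤ : ∀ C D → FTVᴸ C ⊆ FTVᴸ D → #vars C ≤ #vars D
  #vars-≤ C D C⊆D = Unique-⊆⇒length≤ (deduplicate-! (FTVᴸ C))
    (λ z∈ → ∈-deduplicate⁺ _≟_ (C⊆D (∈-deduplicate⁻ _≟_ (FTVᴸ C) z∈)))

  #vars-< : ∀ {α} C D → FTVᴸ C ⊆ FTVᴸ D → α ∈ FTVᴸ D → α ∉ FTVᴸ C → #vars C < #vars D
  #vars-< {α} C D C⊆D α∈D α∉C = Unique-⊆⇒length≤
    (¬Any⇒All¬ _ (λ α∈ → α∉C (∈-deduplicate⁻ _≟_ (FTVᴸ C) α∈)) ∷ deduplicate-! (FTVᴸ C))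
    λ { (here refl) → ∈-deduplicate⁺ _≟_ α∈D
      ; (there z∈)  → ∈-deduplicate⁺ _≟_ (C⊆D (∈-deduplicate⁻ _≟_ (FTVᴸ C) z∈)) }

  FTV-↦ : ∀ {α β τ} τ′ → β ∈ FTV (apply (α ↦ τ) τ′) → β ∈ FTV τ ⊎ (β ∈ FTV τ′ × β ≢ α)
  FTV-↦ {α} (var γ) β∈ with γ ≟ α
  FTV-↦ {α} (var γ) β∈          | yes _   = inj₁ β∈
  FTV-↦ {α} (var γ) (here refl) | no γ≢α = inj₂ (here refl , γ≢α)
  FTV-↦ {α} {τ = τ} (τ₁ ⇒ τ₂) β∈ with ∈-++⁻ (FTV (apply (α ↦ τ) τ₁)) β∈
  FTV-↦ (τ₁ ⇒ τ₂) β∈ | inj₁ p with FTV-↦ τ₁ p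
  ... | inj₁ q       = inj₁ q
  ... | inj₂ (q , r) = inj₂ (∈-++⁺ˡ q , r)
  FTV-↦ (τ₁ ⇒ τ₂) β∈ | inj₂ p with FTV-↦ τ₂ p
  ... | inj₁ q       = inj₁ q
  ... | inj₂ (q , r) = inj₂ (∈-++⁺ʳ (FTV τ₁) q , r)

  FTVᴸ-↦ : ∀ {α β τ} C → β ∈ FTVᴸ (applyᴸ (α ↦ τ) C) → β ∈ FTV τ ⊎ (β ∈ FTVᴸ C × β ≢ α)
  FTVᴸ-↦ {α} {τ = τ} ((τ₁ =ᵉ τ₂) ∷ C) β∈
    with ∈-++⁻ (FTV (apply (α ↦ τ) τ₁) ++ FTV (apply (α ↦ τ) τ₂)) β∈
  FTVᴸ-↦ ((τ₁ =ᵉ τ₂) ∷ C) β∈ | inj₁ p with FTV-↦ (τ₁ ⇒ τ₂) p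
  ... | inj₁ q       = inj₁ q
  ... | inj₂ (q , r) = inj₂ (∈-++⁺ˡ q , r)
  FTVᴸ-↦ ((τ₁ =ᵉ τ₂) ∷ C) β∈ | inj₂ p with FTVᴸ-↦ C p
  ... | inj₁ q       = inj₁ q
  ... | inj₂ (q , r) = inj₂ (∈-++⁺ʳ (FTV τ₁ ++ FTV τ₂) q , r)

  ≺-lex : ∀ C D → #vars C ≤ #vars D →
          ×-Lex _≡_ _<_ _<_ (arrowsᴸ C , length C) (arrowsᴸ D , length D) → C ≺ D
  ≺-lex C D v≤ rest with ℕ.m≤n⇒m<n∨m≡n v≤
  ... | inj₁ v< = decrease (inj₁ v<)
  ... | inj₂ v≡ = decrease (inj₂ (v≡ , rest))

  ≺-drop : ∀ α β C → C ≺ (var α =ᵉ var β) ∷ C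
  ≺-drop α β C = ≺-lex C ((var α =ᵉ var β) ∷ C) (#vars-≤ C ((var α =ᵉ var β) ∷ C) (λ z∈ → there (there z∈)))
    (inj₂ (refl , ℕ.n<1+n (length C)))

  ≺-elimˡ : ∀ {α τ} C → α ∉ FTV τ → applyᴸ (α ↦ τ) C ≺ (var α =ᵉ τ) ∷ C
  ≺-elimˡ {α} {τ} C α∉τ =
    decrease (inj₁ (#vars-< (applyᴸ (α ↦ τ) C) ((var α =ᵉ τ) ∷ C) sub (here refl) α∉))
    where
    sub : FTVᴸ (applyᴸ (α ↦ τ) C) ⊆ FTVᴸ ((var α =ᵉ τ) ∷ C)
    sub z∈ with FTVᴸ-↦ C z∈
    ... | inj₁ p       = there (∈-++⁺ˡ p)
    ... | inj₂ (p , _) = there (∈-++⁺ʳ (FTV τ) p)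

    α∉ : α ∉ FTVᴸ (applyᴸ (α ↦ τ) C)
    α∉ α∈ with FTVᴸ-↦ C α∈
    ... | inj₁ p       = α∉τ p
    ... | inj₂ (_ , r) = r refl

  ≺-elimʳ : ∀ {α τ} C → α ∉ FTV τ → applyᴸ (α ↦ τ) C ≺ (τ =ᵉ var α) ∷ C
  ≺-elimʳ {α} {τ} C α∉τ =
    decrease (inj₁ (#vars-< (applyᴸ (α ↦ τ) C) ((τ =ᵉ var α) ∷ C) sub
                (∈-++⁺ˡ (∈-++⁺ʳ (FTV τ) (here refl))) α∉))
    where
    sub : FTVᴸ (applyᴸ (α ↦ τ) C) ⊆ FTVᴸ ((τ =ᵉ var α) ∷ C)
    sub z∈ with FTVᴸ-↦ C z∈
    ... | inj₁ p       = ∈-++⁺ˡ (∈-++⁺ˡ p)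
    ... | inj₂ (p , _) = ∈-++⁺ʳ (FTV τ ++ [ α ]) p

    α∉ : α ∉ FTVᴸ (applyᴸ (α ↦ τ) C)
    α∉ α∈ with FTVᴸ-↦ C α∈
    ... | inj₁ p       = α∉τ p
    ... | inj₂ (_ , r) = r refl

  ≺-split : ∀ τ₁ τ₂ τ₃ τ₄ C → (τ₁ =ᵉ τ₃) ∷ (τ₂ =ᵉ τ₄) ∷ C ≺ (τ₁ ⇒ τ₂ =ᵉ τ₃ ⇒ τ₄) ∷ C
  ≺-split τ₁ τ₂ τ₃ τ₄ C = ≺-lex C₁ C₂ (#vars-≤ C₁ C₂ sub) (inj₁ fewer)
    where
    C₁ = (τ₁ =ᵉ τ₃) ∷ (τ₂ =ᵉ τ₄) ∷ C
    C₂ = (τ₁ ⇒ τ₂ =ᵉ τ₃ ⇒ τ₄) ∷ C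
    F₁₂ = FTV τ₁ ++ FTV τ₂
    F₃₄ = FTV τ₃ ++ FTV τ₄

    sub : FTVᴸ C₁ ⊆ FTVᴸ C₂
    sub z∈ with ∈-++⁻ (FTV τ₁ ++ FTV τ₃) z∈
    sub z∈ | inj₁ p with ∈-++⁻ (FTV τ₁) p
    ... | inj₁ q = ∈-++⁺ˡ (∈-++⁺ˡ (∈-++⁺ˡ q))
    ... | inj₂ q = ∈-++⁺ˡ (∈-++⁺ʳ F₁₂ (∈-++⁺ˡ q))
    sub z∈ | inj₂ p with ∈-++⁻ (FTV τ₂ ++ FTV τ₄) p
    ... | inj₂ q = ∈-++⁺ʳ (F₁₂ ++ F₃₄) q
    ... | inj₁ q with ∈-++⁻ (FTV τ₂) q
    ...   | inj₁ r = ∈-++⁺ˡ (∈-++⁺ˡ (∈-++⁺ʳ (FTV τ₁) r))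
    ...   | inj₂ r = ∈-++⁺ˡ (∈-++⁺ʳ F₁₂ (∈-++⁺ʳ (FTV τ₃) r))

    fewer : arrowsᴸ C₁ < arrowsᴸ C₂
    fewer = subst (arrowsᴸ C₁ <_)
      (solve 5 (λ w x y z s → con 2 :+ ((w :+ y) :+ ((x :+ z) :+ s))
                           := ((con 1 :+ (w :+ x)) :+ (con 1 :+ (y :+ z))) :+ s)
               refl (arrows τ₁) (arrows τ₂) (arrows τ₃) (arrows τ₄) (arrowsᴸ C))
      (ℕ.m≤n+m (suc (arrowsᴸ C₁)) 1)
      where open +-*-Solver

  unifyAcc : (C : List Constraint) → Acc _≺_ C → Maybe Subst
  unifyAcc [] _ = just ∅
  unifyAcc ((var α =ᵉ var β) ∷ C) (acc rec) with α ≟ β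
  ... | yes _   = unifyAcc C (rec (≺-drop α β C))
  ... | no  α≢β = Maybe.map ((α ↦ var β) ∘_)
                    (unifyAcc (applyᴸ (α ↦ var β) C) (rec (≺-elimˡ C λ { (here α≡β) → α≢β α≡β })))
  unifyAcc ((var α =ᵉ τ@(_ ⇒ _)) ∷ C) (acc rec) with α ∈? FTV τ
  ... | yes _   = nothing
  ... | no  α∉τ = Maybe.map ((α ↦ τ) ∘_)
                    (unifyAcc (applyᴸ (α ↦ τ) C) (rec (≺-elimˡ C α∉τ)))
  unifyAcc ((τ@(_ ⇒ _) =ᵉ var α) ∷ C) (acc rec) with α ∈? FTV τ
  ... | yes _   = nothing
  ... | no  α∉τ = Maybe.map ((α ↦ τ) ∘_)
                    (unifyAcc (applyᴸ (α ↦ τ) C) (rec (≺-elimʳ C α∉τ)))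
  unifyAcc ((τ₁ ⇒ τ₂ =ᵉ τ₃ ⇒ τ₄) ∷ C) (acc rec) =
    unifyAcc ((τ₁ =ᵉ τ₃) ∷ (τ₂ =ᵉ τ₄) ∷ C) (rec (≺-split τ₁ τ₂ τ₃ τ₄ C))

  unify : List Constraint → Maybe Subst
  unify C = unifyAcc C (≺-wellFounded C)

{-# OPTIONS --safe #-}

-- The runs of unify on C and on C ++ C₂ perform the same steps until C is
-- exhausted, at which point the substitution σ found for C has been applied to
-- C₂.  Hence unify (C ++ C₂) is σ composed with unify (σ C₂), on the nose, and
-- no property of unifiers is involved.
module Submission where

open import Defs
open import Data.List.Base using (List; []; _∷_; _++_)
open import Data.List.Properties using (map-++; map-∘; map-cong; map-id)
open import Data.Maybe.Base as Maybe using (Maybe; just; fromMaybe)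
open import Data.Maybe.Properties as Maybe using (just-injective)
open import Data.Maybe.Relation.Binary.Pointwise using (just)
open import Data.Product.Base using (∃; _×_; _,_)
open import Induction.WellFounded using (Acc; acc)
open import Level using (Level)
open import Relation.Binary.Definitions using (DecidableEquality)
open import Relation.Binary.PropositionalEquality
  using (_≡_; refl; sym; trans; cong; cong₂; module ≡-Reasoning)
open import Relation.Nullary using (yes; no)

module UnificationProperties {a : Level} {A : Set a} (_≟_ : DecidableEquality A) where

  open Unification _≟_
  open import Data.List.Membership.DecPropositional _≟_ using (_∈?_)
  open ≡-Reasoning

  apply-cong : ∀ σ ρ → σ ≈ ρ → ∀ τ → apply σ τ ≡ apply ρ τ
  apply-cong σ ρ σ≈ρ (var α)   = σ≈ρ α
  apply-cong σ ρ σ≈ρ (τ₁ ⇒ τ₂) = cong₂ _⇒_ (apply-cong σ ρ σ≈ρ τ₁) (apply-cong σ ρ σ≈ρ τ₂)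

  applyᴸ-cong : ∀ σ ρ → σ ≈ ρ → ∀ C → applyᴸ σ C ≡ applyᴸ ρ C
  applyᴸ-cong σ ρ σ≈ρ = map-cong λ { (τ₁ =ᵉ τ₂) → cong₂ _=ᵉ_ (apply-cong σ ρ σ≈ρ τ₁) (apply-cong σ ρ σ≈ρ τ₂) }

  ≋⇒≈ : ∀ σ ρ → σ ≋ ρ → σ ≈ ρ
  ≋⇒≈ _ _ σ≋ρ α = cong (fromMaybe (var α)) (σ≋ρ α)

  apply-∅ : ∀ τ → apply ∅ τ ≡ τ
  apply-∅ (var α)   = refl
  apply-∅ (τ₁ ⇒ τ₂) = cong₂ _⇒_ (apply-∅ τ₁) (apply-∅ τ₂)

  applyᴸ-∅ : ∀ C → applyᴸ ∅ C ≡ C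
  applyᴸ-∅ C = trans (map-cong (λ { (τ₁ =ᵉ τ₂) → cong₂ _=ᵉ_ (apply-∅ τ₁) (apply-∅ τ₂) }) C) (map-id C)

  -- Composition rewrites the types in `σ` but keeps its keys and their order, so the same binding
  -- is found first; if there is none, both sides look `α` up in `ρ`.
  apply-∘-var : ∀ σ ρ α → apply (σ ∘ ρ) (var α) ≡ apply ρ (apply σ (var α))
  apply-∘-var []            ρ α = refl
  apply-∘-var ((β , τ) ∷ σ) ρ α with α ≟ β
  ... | yes _ = refl
  ... | no  _ = apply-∘-var σ ρ α

  apply-∘ : ∀ σ ρ τ → apply (σ ∘ ρ) τ ≡ apply ρ (apply σ τ)
  apply-∘ σ ρ (var α)   = apply-∘-var σ ρ α
  apply-∘ σ ρ (τ₁ ⇒ τ₂) = cong₂ _⇒_ (apply-∘ σ ρ τ₁) (apply-∘ σ ρ τ₂)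

  applyᴸ-∘ : ∀ σ ρ C → applyᴸ (σ ∘ ρ) C ≡ applyᴸ ρ (applyᴸ σ C)
  applyᴸ-∘ σ ρ C =
    trans (map-cong (λ { (τ₁ =ᵉ τ₂) → cong₂ _=ᵉ_ (apply-∘ σ ρ τ₁) (apply-∘ σ ρ τ₂) }) C) (map-∘ C)

  ∘-congˡ-≈ : ∀ σ ρ θ → σ ≈ ρ → (σ ∘ θ) ≈ (ρ ∘ θ)
  ∘-congˡ-≈ σ ρ θ σ≈ρ α = begin
    apply (σ ∘ θ) (var α)       ≡⟨ apply-∘-var σ θ α ⟩
    apply θ (apply σ (var α))   ≡⟨ cong (apply θ) (σ≈ρ α) ⟩
    apply θ (apply ρ (var α))   ≡⟨ apply-∘-var ρ θ α ⟨
    apply (ρ ∘ θ) (var α)       ∎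

  ∘-congʳ-≈ : ∀ σ ρ θ → ρ ≈ θ → (σ ∘ ρ) ≈ (σ ∘ θ)
  ∘-congʳ-≈ σ ρ θ ρ≈θ α = begin
    apply (σ ∘ ρ) (var α)       ≡⟨ apply-∘-var σ ρ α ⟩
    apply ρ (apply σ (var α))   ≡⟨ apply-cong ρ θ ρ≈θ (apply σ (var α)) ⟩
    apply θ (apply σ (var α))   ≡⟨ apply-∘-var σ θ α ⟨
    apply (σ ∘ θ) (var α)       ∎

  -- The two lists can differ only in the type bound to `α` at the head. An equality of lists,
  -- rather than `≈`, is what keeps `unify-++` an exact equation.
  ↦-∘-assoc : ∀ α τ ρ θ → ((α ↦ τ) ∘ ρ) ∘ θ ≡ (α ↦ τ) ∘ (ρ ∘ θ)
  ↦-∘-assoc α τ ρ θ = cong (λ τ′ → (α , τ′) ∷ (ρ ∘ θ)) (sym (apply-∘ ρ θ τ))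

  -- Accessibility proofs only drive the recursion. Following the clauses of `unifyAcc`, with
  -- recursion on the proofs, avoids any need for `p ≡ q`.
  unifyAcc-irrelevant : ∀ C (p q : Acc _≺_ C) → unifyAcc C p ≡ unifyAcc C q
  unifyAcc-irrelevant [] _ _ = refl
  unifyAcc-irrelevant ((var α =ᵉ var β) ∷ C) (acc _) (acc _) with α ≟ β
  ... | yes _ = unifyAcc-irrelevant C _ _
  ... | no  _ = cong (Maybe.map _) (unifyAcc-irrelevant (applyᴸ (α ↦ var β) C) _ _)
  unifyAcc-irrelevant ((var α =ᵉ τ@(_ ⇒ _)) ∷ C) (acc _) (acc _) with α ∈? FTV τ
  ... | yes _ = refl
  ... | no  _ = cong (Maybe.map _) (unifyAcc-irrelevant (applyᴸ (α ↦ τ) C) _ _)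
  unifyAcc-irrelevant ((τ@(_ ⇒ _) =ᵉ var α) ∷ C) (acc _) (acc _) with α ∈? FTV τ
  ... | yes _ = refl
  ... | no  _ = cong (Maybe.map _) (unifyAcc-irrelevant (applyᴸ (α ↦ τ) C) _ _)
  unifyAcc-irrelevant ((τ₁ ⇒ τ₂ =ᵉ τ₃ ⇒ τ₄) ∷ C) (acc _) (acc _) =
    unifyAcc-irrelevant ((τ₁ =ᵉ τ₃) ∷ (τ₂ =ᵉ τ₄) ∷ C) _ _

  -- Taking `C ≡ D` as an argument spares transporting accessibility proofs along equations between
  -- lists.
  unifyAcc≡unify : ∀ {C D} (p : Acc _≺_ C) → C ≡ D → unifyAcc C p ≡ unify D
  unifyAcc≡unify {C} p refl = unifyAcc-irrelevant C p (≺-wellFounded C)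

  -- The induction step shared by the three clauses that eliminate a variable: `m` and `m₂` stand
  -- for the recursive results without and with `C₂`. Success of the mapped `m` forces `m` to be
  -- some `just ρ`, with `σ` equal to `(α ↦ τ) ∘ ρ`.
  map-elim-++ : ∀ α τ C₂ {m m₂ σ} →
    (∀ {ρ} → m ≡ just ρ → m₂ ≡ Maybe.map (ρ ∘_) (unify (applyᴸ ρ (applyᴸ (α ↦ τ) C₂)))) →
    Maybe.map ((α ↦ τ) ∘_) m ≡ just σ →
    Maybe.map ((α ↦ τ) ∘_) m₂ ≡ Maybe.map (σ ∘_) (unify (applyᴸ σ C₂))
  map-elim-++ α τ C₂ {just ρ} {m₂} ih refl = begin
    Maybe.map (s ∘_) m₂
      ≡⟨ cong (Maybe.map (s ∘_)) (ih refl) ⟩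
    Maybe.map (s ∘_) (Maybe.map (ρ ∘_) (unify (applyᴸ ρ (applyᴸ s C₂))))
      ≡⟨ Maybe.map-∘ (unify (applyᴸ ρ (applyᴸ s C₂))) ⟨
    Maybe.map (λ θ → s ∘ (ρ ∘ θ)) (unify (applyᴸ ρ (applyᴸ s C₂)))
      ≡⟨ Maybe.map-cong (λ θ → sym (↦-∘-assoc α τ ρ θ)) (unify (applyᴸ ρ (applyᴸ s C₂))) ⟩
    Maybe.map ((s ∘ ρ) ∘_) (unify (applyᴸ ρ (applyᴸ s C₂)))
      ≡⟨ cong (λ D → Maybe.map ((s ∘ ρ) ∘_) (unify D)) (sym (applyᴸ-∘ s ρ C₂)) ⟩
    Maybe.map ((s ∘ ρ) ∘_) (unify (applyᴸ (s ∘ ρ) C₂)) ∎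
    where s = α ↦ τ

  -- Recursion is on `p`; `q` is arbitrary because the subproofs met along the run are not those of
  -- `≺-wellFounded`. A failure on the instantiated `C₂` is carried through by `Maybe.map`.
  unifyAcc-++ : ∀ C C₂ (p : Acc _≺_ C) (q : Acc _≺_ (C ++ C₂)) {σ} → unifyAcc C p ≡ just σ →
    unifyAcc (C ++ C₂) q ≡ Maybe.map (σ ∘_) (unify (applyᴸ σ C₂))

  -- After an elimination the list is `applyᴸ s (C ++ C₂)`, which is an append only up to `map-++`.
  -- Passing `p` on unchanged keeps the mutual recursion structural.
  unifyAcc-applyᴸ-++ : ∀ s C C₂ (p : Acc _≺_ (applyᴸ s C)) (q : Acc _≺_ (applyᴸ s (C ++ C₂))) {σ} →
    unifyAcc (applyᴸ s C) p ≡ just σ →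
    unifyAcc (applyᴸ s (C ++ C₂)) q ≡ Maybe.map (σ ∘_) (unify (applyᴸ σ (applyᴸ s C₂)))

  -- Here `σ` is `∅`, and `∅ ∘_` computes to the identity, so `Maybe.map-id` applies.
  unifyAcc-++ [] C₂ _ q refl =
    trans (unifyAcc≡unify q (sym (applyᴸ-∅ C₂))) (sym (Maybe.map-id _))
  unifyAcc-++ ((var α =ᵉ var β) ∷ C) C₂ (acc _) (acc _) with α ≟ β
  ... | yes _ = unifyAcc-++ C C₂ _ _
  ... | no  _ = map-elim-++ α (var β) C₂ (unifyAcc-applyᴸ-++ (α ↦ var β) C C₂ _ _)
  unifyAcc-++ ((var α =ᵉ τ@(_ ⇒ _)) ∷ C) C₂ (acc _) (acc _) with α ∈? FTV τ
  ... | yes _ = λ ()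
  ... | no  _ = map-elim-++ α τ C₂ (unifyAcc-applyᴸ-++ (α ↦ τ) C C₂ _ _)
  unifyAcc-++ ((τ@(_ ⇒ _) =ᵉ var α) ∷ C) C₂ (acc _) (acc _) with α ∈? FTV τ
  ... | yes _ = λ ()
  ... | no  _ = map-elim-++ α τ C₂ (unifyAcc-applyᴸ-++ (α ↦ τ) C C₂ _ _)
  unifyAcc-++ ((τ₁ ⇒ τ₂ =ᵉ τ₃ ⇒ τ₄) ∷ C) C₂ (acc _) (acc _) =
    unifyAcc-++ ((τ₁ =ᵉ τ₃) ∷ (τ₂ =ᵉ τ₄) ∷ C) C₂ _ _

  unifyAcc-applyᴸ-++ s C C₂ p q eq = trans
    (unifyAcc≡unify q (map-++ (applyᶜ s) C C₂))
    (unifyAcc-++ (applyᴸ s C) (applyᴸ s C₂) p (≺-wellFounded _) eq)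

  unify-++ : ∀ C C₂ {σ} → unify C ≡ just σ →
    unify (C ++ C₂) ≡ Maybe.map (σ ∘_) (unify (applyᴸ σ C₂))
  unify-++ C C₂ = unifyAcc-++ C C₂ (≺-wellFounded C) (≺-wellFounded (C ++ C₂))

  -- Recovers the list `ρ` actually computed, to which the exact equation `unify-++` applies.
  ≋ₘ-just⁻ : ∀ {m σ} → m ≋ₘ just σ → ∃ λ ρ → m ≡ just ρ × ρ ≈ σ
  ≋ₘ-just⁻ {σ = σ} (just {ρ} ρ≋σ) = ρ , refl , ≋⇒≈ ρ σ ρ≋σ

  unify-++-≈ : ∀ C C₂ σ′ σ″ σ‴ →
    unify C ≋ₘ just σ′ →
    unify (applyᴸ σ′ C₂) ≋ₘ just σ″ →
    unify (C ++ C₂) ≋ₘ just σ‴ →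
    σ‴ ≈ (σ′ ∘ σ″)
  unify-++-≈ C C₂ σ′ σ″ σ‴ h′ h″ h‴ α
    with ρ′ , eq′ , ρ′≈σ′ ← ≋ₘ-just⁻ h′
    with ρ″ , eq″ , ρ″≈σ″ ← ≋ₘ-just⁻ h″
    with ρ‴ , eq‴ , ρ‴≈σ‴ ← ≋ₘ-just⁻ h‴ = begin
      apply σ‴ (var α)         ≡⟨ ρ‴≈σ‴ α ⟨
      apply ρ‴ (var α)         ≡⟨ cong (λ θ → apply θ (var α)) (just-injective ρ‴≡ρ′∘ρ″) ⟩
      apply (ρ′ ∘ ρ″) (var α)  ≡⟨ ∘-congˡ-≈ ρ′ σ′ ρ″ ρ′≈σ′ α ⟩
      apply (σ′ ∘ ρ″) (var α)  ≡⟨ ∘-congʳ-≈ σ′ ρ″ σ″ ρ″≈σ″ α ⟩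
      apply (σ′ ∘ σ″) (var α)  ∎
    where
    ρ‴≡ρ′∘ρ″ : just ρ‴ ≡ just (ρ′ ∘ ρ″)
    ρ‴≡ρ′∘ρ″ = begin
      just ρ‴                                   ≡⟨ eq‴ ⟨
      unify (C ++ C₂)                           ≡⟨ unify-++ C C₂ eq′ ⟩
      -- Extensionally equal substitutions yield the very same constraint list, so both runs of
      -- `unify` have the same input.
      Maybe.map (ρ′ ∘_) (unify (applyᴸ ρ′ C₂))  ≡⟨ cong (λ D → Maybe.map (ρ′ ∘_) (unify D)) (applyᴸ-cong ρ′ σ′ ρ′≈σ′ C₂) ⟩
      Maybe.map (ρ′ ∘_) (unify (applyᴸ σ′ C₂))  ≡⟨ cong (Maybe.map (ρ′ ∘_)) eq″ ⟩
      just (ρ′ ∘ ρ″)                            ∎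

theorem8 : ∀ {a : Level} {A : Set a} (_≟_ : DecidableEquality A) →
    let open Unification _≟_ in
    (C C₂ : List Constraint) (σ′ σ″ σ‴ : Subst) →
    unify C ≋ₘ just σ′ →
    unify (applyᴸ σ′ C₂) ≋ₘ just σ″ →
    unify (C ++ C₂) ≋ₘ just σ‴ →
    σ‴ ≈ (σ′ ∘ σ″)
theorem8 = UnificationProperties.unify-++-≈
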